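{- Let $x$ be a hypergame. Then either there exists a winning strategy on $x$ for exactly one of the players L, R, I, II, and there are no non-losing strategies on $x$ for the other players; or at least two of L, R, I, II have a non-losing strategy on $x$. In this latter case, either (i) or (ii) holds: (i) either L or R (but not both) has a non-losing strategy, and either I or II (but not both) has a non-losing strategy; (ii) all the players L, R, I, II have a non-losing strategy.
   Context: Hypergames: work in a universe of possibly non-wellfounded sets (set theory with the Antifoundation Axiom, and the Axiom of Choice). The class $\mathcal H$ of hypergames (also called games) is the carrier of the final coalgebra $(\mathcal H,\mathrm{id})$ of the functor $F(A)=\mathcal P(A)\times\mathcal P(A)$ on the category of classes and functional classes, where $\mathcal P$ is the powerset functor. Thus a hypergame is a pair $x=(X^L,X^R)$ of sets of hypergames; elements $x^L\in X^L$ and $x^R\in X^R$ are the Left and Right options of $x$. Positions of $x$ are the hypergames hereditarily reachable from $x$. Plays: L (Left) and R (Right) move alternately; either may start. Player I is the one who starts, player II the other one; LI means L acting as player I, and similarly LII, RI, RII. A play on $x$ is a (possibly empty) finite or infinite sequence $x_1^{K_1}x_2^{K_2}\cdots$ with $K_i\in\{L,R\}$ and $K_{i+1}\neq K_i$, such that, with $x_0=x$ and $x_i=(X_i^L,X_i^R)$, one has $x_{i+1}\in X_i^{K_{i+1}}$ for all $i\ge 0$. A finite play is winning for L (resp. R) if it ends with a position $y=(Y^L,Y^R)$ where R (resp. L) is next to move but $Y^R=\emptyset$ (resp. $Y^L=\emptyset$); the empty play ends at $x$ with the starting player next to move. Every infinite play is a draw. A play is non-losing for L (resp. R) if it is winning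 for L (resp. R) or is a draw. Strategies: for P in $\{$LI, LII, RI, RII$\}$ let $\mathrm{FPlay}^P_x$ be the set of finite plays on $x$ in which P has the prescribed role (first or second player) and is next to move (the empty play is included exactly when P is LI or RI). A strategy for P on $x$ is a partial function $f$ from $\mathrm{FPlay}^P_x$ to positions of $x$ such that $f(\pi)=x'$ implies that $\pi x'$ is a play, and $f(\pi)$ is defined whenever some $\pi x'$ is a play. The opponent of LI is RII, and of LII is RI (and conversely). A play $\pi$ is coherent with $f$ if for each proper prefix $\pi'$ of $\pi$ where P is next to move, $f(\pi')=x'$ implies $\pi'x'$ is a prefix of $\pi$. For a strategy $f$ for P and a strategy $f'$ for the opponent, $f*f'$ is the unique maximal play coherent with both. $f$ is non-losing (winning) for P if $f*f'$ is non-losing (winning) for P (i.e. for L or R accordingly) for every strategy $f'$ of the opponent. A strategy for L is a pair of strategies for LI and LII; for R, for RI and RII; for I, for LI and RI; for II, for LII and RII. Such a pair is non-losing (winning) if both components are. -}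

module Defs where

open import Data.Empty.Polymorphic using (⊥)
open import Data.List.Base using (List; []; _∷_; _∷ʳ_; length; applyUpTo)
open import Data.List.Relation.Binary.Pointwise using (Pointwise)
open import Data.List.Relation.Binary.Prefix.Heterogeneous using (Prefix)
open import Data.Maybe using (Maybe; just; Is-just)
import Data.Maybe.Relation.Binary.Pointwise as Maybe
open import Data.Nat.Base using (ℕ)
open import Data.Product using (Σ; Σ-syntax; ∃; ∃-syntax; _×_; _,_; proj₁; proj₂)
open import Data.Product.Relation.Binary.Pointwise.NonDependent using (×-setoid)
open import Data.Sum.Base using (_⊎_)
open import Data.Unit.Polymorphic using (⊤)
open import Function.Base using (_∘_)
open import Function.Bundles using (Func; Surjection)
open import Level using (Level; suc; _⊔_)
open import Relation.Binary.Bundles using (Setoid)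
open import Relation.Binary.PropositionalEquality using (_≡_; refl; subst)
open import Relation.Nullary using (¬_)

private
  variable
    a b e ℓ : Level

-- Every surjection of sets has a section.  Sets are setoids, so the section
-- has to respect equality; this is the choice principle of classical set
-- theory and not the type-theoretic one, which is provable.
AxiomOfChoice : ∀ a e → Set (suc (a ⊔ e))
AxiomOfChoice a e =
  (A B : Setoid a e) (S : Surjection A B) →
  Σ[ g ∈ Func B A ] (∀ y → Setoid._≈_ B (Surjection.to S (Func.to g y)) y)

------------------------------------------------------------------------
-- The functor F(A) = 𝒫(A) × 𝒫(A) on classes
--
-- Relative to a level ℓ, a "class" is a setoid on level suc ℓ and a "set" of
-- elements of a class is a family indexed by a type on level ℓ.  Two families
-- are equal when they have the same elements, so order and repetition of the
-- members of a family are immaterial.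

𝒫 : (ℓ : Level) → Set a → Set (suc ℓ ⊔ a)
𝒫 ℓ A = Σ[ I ∈ Set ℓ ] (I → A)

𝒫-map : {A : Set a} {B : Set b} → (A → B) → 𝒫 ℓ A → 𝒫 ℓ B
𝒫-map f (I , x) = I , f ∘ x

SameElements : {A : Set a} {B : Set b} (_∼_ : A → B → Set e) → 𝒫 ℓ A → 𝒫 ℓ B → Set (ℓ ⊔ e)
SameElements _∼_ (I , x) (J , y) =
  (∀ i → ∃[ j ] (x i ∼ y j)) × (∀ j → ∃[ i ] (x i ∼ y j))

𝒫-setoid : (ℓ : Level) → Setoid a e → Setoid (suc ℓ ⊔ a) (ℓ ⊔ e)
𝒫-setoid ℓ A = record
  { Carrier       = 𝒫 ℓ Carrier
  ; _≈_           = SameElements _≈_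
  ; isEquivalence = record
    { refl  = (λ i → i , A.refl) , (λ i → i , A.refl)
    ; sym   = λ (to , from) →
        (λ j → let (i , p) = from j in i , A.sym p) ,
        (λ i → let (j , p) = to i in j , A.sym p)
    ; trans = λ (to₁ , from₁) (to₂ , from₂) →
        (λ i → let (j , p) = to₁ i ; (k , q) = to₂ j in k , A.trans p q) ,
        (λ k → let (j , q) = from₂ k ; (i , p) = from₁ j in i , A.trans p q)
    }
  }
  where
  module A = Setoid A
  open A using (Carrier; _≈_)

Class : (ℓ : Level) → Set (suc (suc ℓ))
Class ℓ = Setoid (suc ℓ) (suc ℓ)

F : Class ℓ → Class ℓ
F {ℓ} A = ×-setoid (𝒫-setoid ℓ A) (𝒫-setoid ℓ A)

F-map : {A : Set a} {B : Set b} → (A → B) → 𝒫 ℓ A × 𝒫 ℓ A → 𝒫 ℓ B × 𝒫 ℓ B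
F-map f (X , Y) = 𝒫-map f X , 𝒫-map f Y

record Coalgebra (ℓ : Level) : Set (suc (suc ℓ)) where
  field
    carrier   : Class ℓ
    structure : Func carrier (F carrier)

  open Setoid carrier public
  open Func structure public using () renaming (to to str; cong to str-cong)

record Morphism (A B : Coalgebra ℓ) : Set (suc ℓ) where
  private
    module A = Coalgebra A
    module B = Coalgebra B
  field
    function : Func A.carrier B.carrier

  open Func function public

  field
    commutes : ∀ x → Setoid._≈_ (F B.carrier) (F-map to (A.str x)) (B.str (to x))

IsFinal : Coalgebra ℓ → Set (suc (suc ℓ))
IsFinal {ℓ} H =
  (A : Coalgebra ℓ) →
  Σ[ h ∈ Morphism A H ] ((h′ : Morphism A H) → ∀ x → Morphism.to h x ≈ Morphism.to h′ x)
  where open Coalgebra H using (_≈_)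

FinalCoalgebra : (ℓ : Level) → Set (suc (suc ℓ))
FinalCoalgebra ℓ = Σ[ H ∈ Coalgebra ℓ ] IsFinal H

------------------------------------------------------------------------
-- Players

data Side : Set where
  left right : Side

opp : Side → Side
opp left  = right
opp right = left

-- LI is L acting as player I (the one who starts), and so on.
data Role : Set where
  LI LII RI RII : Role

side : Role → Side
side LI  = left
side LII = left
side RI  = right
side RII = right

starter : Role → Side
starter LI  = left
starter LII = right
starter RI  = right
starter RII = left

opponent : Role → Role
opponent LI  = RII
opponent LII = RI
opponent RI  = LII
opponent RII = LI

data Player : Set where
  L R I II : Player

roles : Player → Role × Role
roles L  = LI  , LII
roles R  = RI  , RII
roles I  = LI  , RI
roles II = LII , RII

------------------------------------------------------------------------
-- Hypergames, plays and strategies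
--
-- The structure map of the final coalgebra is an isomorphism; it takes a
-- hypergame x to the pair (X^L , X^R).

module Hypergames {ℓ : Level} (𝓗 : FinalCoalgebra ℓ) where

  open Coalgebra (proj₁ 𝓗) using (_≈_; str) renaming (Carrier to Hypergame) public

  options : Side → Hypergame → 𝒫 ℓ Hypergame
  options left  x = proj₁ (str x)
  options right x = proj₂ (str x)

  _∈_ : Hypergame → 𝒫 ℓ Hypergame → Set (suc ℓ)
  y ∈ (_ , x) = ∃[ i ] (y ≈ x i)

  -- The labels of a sequence of alternating moves are determined by the side
  -- which starts, so only the hypergames x₁ x₂ … are recorded and the starting
  -- side is a parameter of the notions below.
  data Sequence : Set (suc ℓ) where
    fin : List Hypergame → Sequence
    inf : (ℕ → Hypergame) → Sequence

  data IsFinitePlay : Side → Hypergame → List Hypergame → Set (suc ℓ) where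
    []  : ∀ {k x} → IsFinitePlay k x []
    _∷_ : ∀ {k x y ys} → y ∈ options k x → IsFinitePlay (opp k) y ys → IsFinitePlay k x (y ∷ ys)

  -- applyUpTo xs n is the list of the first n members of xs.
  IsPlay : Side → Hypergame → Sequence → Set (suc ℓ)
  IsPlay k x (fin xs) = IsFinitePlay k x xs
  IsPlay k x (inf xs) = ∀ n → IsFinitePlay k x (applyUpTo xs n)

  toMove : Side → List Hypergame → Side
  toMove k []       = k
  toMove k (_ ∷ xs) = toMove (opp k) xs

  finalPosition : Hypergame → List Hypergame → Hypergame
  finalPosition x []       = x
  finalPosition _ (y ∷ ys) = finalPosition y ys

  -- Here and in NonLosingPlay, s is the side for which the play is winning or
  -- non-losing, k the starting side and x the initial position.
  WinningPlay : (s k : Side) → Hypergame → Sequence → Set (suc ℓ)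
  WinningPlay s k x (fin xs) =
    toMove k xs ≡ opp s × (∀ y → ¬ (y ∈ options (opp s) (finalPosition x xs)))
  WinningPlay s k x (inf _)  = ⊥

  Draw : Sequence → Set (suc ℓ)
  Draw (fin _) = ⊥
  Draw (inf _) = ⊤

  NonLosingPlay : (s k : Side) → Hypergame → Sequence → Set (suc ℓ)
  NonLosingPlay s k x π = WinningPlay s k x π ⊎ Draw π

  _⊑_ : List Hypergame → Sequence → Set (suc ℓ)
  xs ⊑ fin ys = Prefix _≈_ xs ys
  xs ⊑ inf ys = Pointwise _≈_ xs (applyUpTo ys (length xs))

  _⊏_ : List Hypergame → Sequence → Set (suc ℓ)
  xs ⊏ π = ∃[ y ] ((xs ∷ʳ y) ⊑ π)

  -- The prefix order on possibly infinite sequences.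
  _≼_ : Sequence → Sequence → Set (suc ℓ)
  π ≼ ρ = ∀ xs → xs ⊑ π → xs ⊑ ρ

  record FPlay (P : Role) (x : Hypergame) : Set (suc ℓ) where
    field
      moves  : List Hypergame
      isPlay : IsFinitePlay (starter P) x moves
      turn   : toMove (starter P) moves ≡ side P

  open FPlay public

  -- A partial function is one with values in Maybe.  That its values are
  -- positions of x is part of 'legal'.
  record Strategy (x : Hypergame) (P : Role) : Set (suc ℓ) where
    field
      move    : FPlay P x → Maybe Hypergame
      cong    : ∀ π ρ → Pointwise _≈_ (moves π) (moves ρ) →
                Maybe.Pointwise _≈_ (move π) (move ρ)
      legal   : ∀ π y → move π ≡ just y → IsFinitePlay (starter P) x (moves π ∷ʳ y)
      defined : ∀ π y → IsFinitePlay (starter P) x (moves π ∷ʳ y) → Is-just (move π)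

  open Strategy public using (move)

  Coherent : ∀ {x P} → Strategy x P → Sequence → Set (suc ℓ)
  Coherent {x} {P} f π =
    ∀ (ρ : FPlay P x) y → moves ρ ⊏ π → move f ρ ≡ just y → (moves ρ ∷ʳ y) ⊑ π

  -- π is the play f * f′.
  record IsOutcome {x P} (f : Strategy x P) (f′ : Strategy x (opponent P))
                   (π : Sequence) : Set (suc ℓ) where
    field
      isPlay    : IsPlay (starter P) x π
      coherent  : Coherent f π
      coherent′ : Coherent f′ π
      maximal   : ∀ ρ → IsPlay (starter P) x ρ → Coherent f ρ → Coherent f′ ρ → π ≼ ρ → ρ ≼ π

  NonLosing : ∀ {x P} → Strategy x P → Set (suc ℓ)
  NonLosing {x} {P} f =
    ∀ f′ → ∃[ π ] (IsOutcome f f′ π × NonLosingPlay (side P) (starter P) x π)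

  Winning : ∀ {x P} → Strategy x P → Set (suc ℓ)
  Winning {x} {P} f =
    ∀ f′ → ∃[ π ] (IsOutcome f f′ π × WinningPlay (side P) (starter P) x π)

  PlayerStrategy : Hypergame → Player → Set (suc ℓ)
  PlayerStrategy x p = Strategy x (proj₁ (roles p)) × Strategy x (proj₂ (roles p))

  HasNonLosing : Hypergame → Player → Set (suc ℓ)
  HasNonLosing x p = Σ[ (f , g) ∈ PlayerStrategy x p ] (NonLosing f × NonLosing g)

  HasWinning : Hypergame → Player → Set (suc ℓ)
  HasWinning x p = Σ[ (f , g) ∈ PlayerStrategy x p ] (Winning f × Winning g)

ExactlyOneOf : Set a → Set b → Set (a ⊔ b)
ExactlyOneOf A B = (A ⊎ B) × ¬ (A × B)

------------------------------------------------------------------------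
-- Existence of the final coalgebra
--
-- Its elements are pointed small coalgebras up to bisimilarity, as in the
-- Antifoundation Axiom: every pointed graph is a picture of a unique set.

component : {A : Set a} → Side → A × A → A
component left  = proj₁
component right = proj₂

module Existence (ℓ : Level) where

  record Picture : Set (suc ℓ) where
    constructor picture
    field
      Node : Set ℓ
      arcs : Node → 𝒫 ℓ Node × 𝒫 ℓ Node
      root : Node

  open Picture

  at : (x : Picture) → Node x → Picture
  at x m = record x { root = m }

  opts : Picture → Side → 𝒫 ℓ Picture
  opts x k = 𝒫-map (at x) (component k (arcs x (root x)))

  IsBisimulation : {A : Set a} {B : Set b} (α : A → Side → 𝒫 ℓ A) (β : B → Side → 𝒫 ℓ B)
                   (_∼_ : A → B → Set e) → Set (ℓ ⊔ a ⊔ b ⊔ e)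
  IsBisimulation α β _∼_ = ∀ {x y} → x ∼ y → ∀ k → SameElements _∼_ (α x k) (β y k)

  arcsOf : (x : Picture) → Node x → Side → 𝒫 ℓ (Node x)
  arcsOf x m k = component k (arcs x m)

  record _≈ᵖ_ (x y : Picture) : Set (suc ℓ) where
    field
      _∼_    : Node x → Node y → Set ℓ
      bisim  : IsBisimulation (arcsOf x) (arcsOf y) _∼_
      rooted : root x ∼ root y

  open _≈ᵖ_

  unroll : ∀ {x y} → x ≈ᵖ y → ∀ k → SameElements _≈ᵖ_ (opts x k) (opts y k)
  unroll {x} {y} p k =
    let (to , from) = bisim p (rooted p) k
    in (λ i → let (j , r) = to i in j , below r) , (λ j → let (i , r) = from j in i , below r)
    where
    below : ∀ {m n} → _∼_ p m n → at x m ≈ᵖ at y n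
    below r = record { _∼_ = _∼_ p ; bisim = bisim p ; rooted = r }

  -- Coinduction for bisimulations on level suc ℓ: the pairs reached from a
  -- given one along the chosen matchings form a bisimulation on level ℓ.
  module Coinduction (_≋_ : Picture → Picture → Set (suc ℓ)) (bis : IsBisimulation opts opts _≋_) where

    data Reach (x y : Picture) (r : x ≋ y) : Set ℓ where
      here  : Reach x y r
      forth : ∀ k i → Reach _ _ (proj₂ (proj₁ (bis r k) i)) → Reach x y r
      back  : ∀ k j → Reach _ _ (proj₂ (proj₂ (bis r k) j)) → Reach x y r

    record End (x y : Picture) : Set (suc ℓ) where
      constructor end
      field
        fst : Node x
        snd : Node y
        rel : at x fst ≋ at y snd

    open End

    follow : ∀ {x y r} → Reach x y r → End x y
    follow {x} {y} {r} here = end (root x) (root y) r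
    follow {r = r} (forth k i t) = let e = follow t in end (fst e) (snd e) (rel e)
    follow {r = r} (back k j t)  = let e = follow t in end (fst e) (snd e) (rel e)

    extend-forth : ∀ {x y r} (t : Reach x y r) k i →
      Σ[ u ∈ Reach x y r ]
        (fst (follow u) ≡ proj₂ (arcsOf x (fst (follow t)) k) i ×
         snd (follow u) ≡ proj₂ (arcsOf y (snd (follow t)) k) (proj₁ (proj₁ (bis (rel (follow t)) k) i)))
    extend-forth here          k i = forth k i here , refl , refl
    extend-forth (forth l j t) k i = let (u , p) = extend-forth t k i in forth l j u , p
    extend-forth (back l j t)  k i = let (u , p) = extend-forth t k i in back l j u , p

    extend-back : ∀ {x y r} (t : Reach x y r) k j →
      Σ[ u ∈ Reach x y r ]
        (fst (follow u) ≡ proj₂ (arcsOf x (fst (follow t)) k) (proj₁ (proj₂ (bis (rel (follow t)) k) j)) ×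
         snd (follow u) ≡ proj₂ (arcsOf y (snd (follow t)) k) j)
    extend-back here          k i = back k i here , refl , refl
    extend-back (forth l j t) k i = let (u , p) = extend-back t k i in forth l j u , p
    extend-back (back l j t)  k i = let (u , p) = extend-back t k i in back l j u , p

    coinduct : ∀ {x y} → x ≋ y → x ≈ᵖ y
    coinduct {x} {y} r = record
      { _∼_    = λ m n → Σ[ t ∈ Reach x y r ] (fst (follow t) ≡ m × snd (follow t) ≡ n)
      ; bisim  = λ { (t , refl , refl) k → (λ i → _ , extend-forth t k i) , (λ j → _ , extend-back t k j) }
      ; rooted = here , refl , refl
      }

  open Coinduction using (coinduct)

  pictures : Class ℓ
  pictures = record
    { Carrier = Picture
    ; _≈_     = _≈ᵖ_
    ; isEquivalence = record
      { refl  = record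
        { _∼_ = _≡_ ; bisim = λ { refl k → (λ i → i , refl) , (λ i → i , refl) } ; rooted = refl }
      ; sym   = λ p → record
        { _∼_    = λ n m → _∼_ p m n
        ; bisim  = λ r k → proj₂ (bisim p r k) , proj₁ (bisim p r k)
        ; rooted = rooted p
        }
      ; trans = λ p q → record
        { _∼_    = λ m o → ∃[ n ] (_∼_ p m n × _∼_ q n o)
        ; bisim  = λ (_ , r , s) k →
            (λ i → let (j , r′) = proj₁ (bisim p r k) i
                       (l , s′) = proj₁ (bisim q s k) j in l , _ , r′ , s′) ,
            (λ l → let (j , s′) = proj₂ (bisim q s k) l
                       (i , r′) = proj₂ (bisim p r k) j in i , _ , r′ , s′)
        ; rooted = _ , rooted p , rooted q
        }
      }
    }

  pictureCoalgebra : Coalgebra ℓ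
  pictureCoalgebra = record
    { carrier   = pictures
    ; structure = record { to = λ x → opts x left , opts x right ; cong = λ p → unroll p left , unroll p right }
    }

  sides : {A : Set a} {B : Set b} {_∼_ : A → B → Set e} {X : 𝒫 ℓ A × 𝒫 ℓ A} {Y : 𝒫 ℓ B × 𝒫 ℓ B} →
          SameElements _∼_ (proj₁ X) (proj₁ Y) × SameElements _∼_ (proj₂ X) (proj₂ Y) →
          ∀ k → SameElements _∼_ (component k X) (component k Y)
  sides p left  = proj₁ p
  sides p right = proj₂ p

  module Unfold (A : Coalgebra ℓ) where

    open Coalgebra A using (Carrier; _≈_; str; str-cong) renaming (refl to ≈-refl; sym to ≈-sym; trans to ≈-trans)

    succ : Carrier → Side → 𝒫 ℓ Carrier
    succ c k = component k (str c)

    data Path (c : Carrier) : Set ℓ where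
      stop : Path c
      go   : ∀ k (i : proj₁ (succ c k)) → Path (proj₂ (succ c k) i) → Path c

    target : ∀ {c} → Path c → Carrier
    target {c} stop   = c
    target (go k i p) = target p

    extend : ∀ {c} (p : Path c) k → proj₁ (succ (target p) k) → Path c
    extend stop       k j = go k j stop
    extend (go l i p) k j = go l i (extend p k j)

    target-extend : ∀ {c} (p : Path c) k j → target (extend p k j) ≡ proj₂ (succ (target p) k) j
    target-extend stop       k j = refl
    target-extend (go l i p) k j = target-extend p k j

    tree : Carrier → Picture
    tree c = picture (Path c)
      (λ p → (proj₁ (succ (target p) left)  , extend p left) ,
             (proj₁ (succ (target p) right) , extend p right))
      stop

    data SameTarget : Picture → Picture → Set (suc ℓ) where
      same : ∀ {c d} (p : Path c) (q : Path d) → target p ≈ target q →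
             SameTarget (at (tree c) p) (at (tree d) q)

    ≡⇒≈ : ∀ {c d} → c ≡ d → c ≈ d
    ≡⇒≈ refl = ≈-refl

    related : ∀ {c d} (p : Path c) (q : Path d) k i j →
              proj₂ (succ (target p) k) i ≈ proj₂ (succ (target q) k) j →
              SameTarget (at (tree c) (extend p k i)) (at (tree d) (extend q k j))
    related p q k i j e = same _ _
      (≈-trans (≡⇒≈ (target-extend p k i)) (≈-trans e (≈-sym (≡⇒≈ (target-extend q k j)))))

    sameTarget-bisim : IsBisimulation opts opts SameTarget
    sameTarget-bisim (same p q e) left =
      let (to , from) = proj₁ (str-cong e) in
      (λ i → let (j , e′) = to i in j , related p q left i j e′) ,
      (λ j → let (i , e′) = from j in i , related p q left i j e′)
    sameTarget-bisim (same p q e) right =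
      let (to , from) = proj₂ (str-cong e) in
      (λ i → let (j , e′) = to i in j , related p q right i j e′) ,
      (λ j → let (i , e′) = from j in i , related p q right i j e′)

    sameTarget : ∀ {c d} (p : Path c) (q : Path d) → target p ≈ target q → at (tree c) p ≈ᵖ at (tree d) q
    sameTarget p q e = coinduct SameTarget sameTarget-bisim (same p q e)

    unfold : Morphism A pictureCoalgebra
    unfold = record
      { function = record { to = tree ; cong = λ e → sameTarget stop stop e }
      ; commutes = λ c → step c left , step c right
      }
      where
      step : ∀ c k → SameElements _≈ᵖ_ (𝒫-map tree (succ c k)) (opts (tree c) k)
      step c left  = (λ i → i , sameTarget stop (go left i stop) ≈-refl) , (λ i → i , sameTarget stop (go left i stop) ≈-refl)
      step c right = (λ i → i , sameTarget stop (go right i stop) ≈-refl) , (λ i → i , sameTarget stop (go right i stop) ≈-refl)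

    module Unique (h h′ : Morphism A pictureCoalgebra) where

      open Morphism
      open Setoid pictures using () renaming (sym to symᵖ; trans to transᵖ)

      Images : Picture → Picture → Set (suc ℓ)
      Images x y = ∃[ c ] (x ≈ᵖ to h c × to h′ c ≈ᵖ y)

      images-bisim : IsBisimulation opts opts Images
      images-bisim {x} {y} (c , p , q) k =
        (λ i → let (i₁ , p₁) = proj₁ P i ; (l , e) = proj₂ H i₁
                   (j₁ , e′) = proj₁ H′ l ; (j , q₁) = proj₁ Q j₁
               in j , _ , transᵖ p₁ (symᵖ e) , transᵖ e′ q₁) ,
        (λ j → let (j₁ , q₁) = proj₂ Q j ; (l , e′) = proj₂ H′ j₁
                   (i₁ , e) = proj₁ H l ; (i , p₁) = proj₂ P i₁
               in i , _ , transᵖ p₁ (symᵖ e) , transᵖ e′ q₁)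
        where
        along : (g : Morphism A pictureCoalgebra) → ∀ k →
                SameElements _≈ᵖ_ (𝒫-map (to g) (succ c k)) (opts (to g c) k)
        along g left  = proj₁ (commutes g c)
        along g right = proj₂ (commutes g c)
        P  = unroll p k
        Q  = unroll q k
        H  = along h k
        H′ = along h′ k

      unique : ∀ c → to h c ≈ᵖ to h′ c
      unique c = coinduct Images images-bisim (c , Setoid.refl pictures , Setoid.refl pictures)

  finalCoalgebra : FinalCoalgebra ℓ
  finalCoalgebra = pictureCoalgebra , λ A → let open Unfold A in unfold , λ h′ → Unique.unique unfold h′

{-# OPTIONS --safe #-}
module Submission where

-- For a fixed starting side, Left and Right play a game in which infinite plays
-- are draws.  Call a position won for a side if this follows inductively: some
-- own move, or every move of the other side, leads to a won position.  Following
-- a derivation of "won" is a winning strategy, since the derivations met along an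
-- infinite play would decrease forever; staying among the positions not won for
-- the other side is a non-losing strategy, since a side at an unwon position of
-- the other always has a move.  Hence each of the two games (Left or Right
-- starting) is won by one side or drawn, and the nine combinations give the
-- theorem.
--
-- Strategies must respect equality of hypergames, while derivations are about
-- indexed options.  Choice is used once, to enumerate every set of options
-- without repetition; a play then determines the indices of its moves.

open import Defs
open import Axiom.ExcludedMiddle using (ExcludedMiddle)
open import Axiom.UniquenessOfIdentityProofs.WithK using (uip)
open import Data.Empty using (⊥-elim)
open import Data.List.Base using (List; []; _∷_; _∷ʳ_; length; applyUpTo)
open import Data.List.Properties using (length-applyUpTo; applyUpTo-∷ʳ; length-++)
open import Data.List.Relation.Binary.Pointwise as Pointwise using (Pointwise; []; _∷_)
open import Data.List.Relation.Binary.Prefix.Heterogeneous using (Prefix; []; _∷_)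
import Data.List.Relation.Binary.Prefix.Heterogeneous.Properties as Prefix
open import Data.List.Reverse using (Reverse; []; _∶_∶ʳ_; reverseView)
open import Data.Maybe as Maybe using (Maybe; just; nothing; Is-just)
import Data.Maybe.Relation.Binary.Pointwise as Maybe
import Data.Maybe.Relation.Unary.Any as Any
open import Data.Nat.Base using (ℕ; zero; _≤_; s≤s)
open import Data.Nat.Properties using (≤-reflexive; 1+n≰n)
open import Data.Product using (Σ; Σ-syntax; ∃-syntax; _×_; _,_; proj₁; proj₂)
open import Data.Sum.Base using (_⊎_; inj₁; inj₂)
open import Data.Unit.Polymorphic using (⊤; tt)
open import Function.Base using (_∘_)
open import Function.Bundles using (Func)
open import Induction.WellFounded using (WellFounded; Acc; acc)
open import Level using (Level; suc; Lift; lift; lower; _⊔_)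
open import Relation.Binary.Bundles using (Setoid)
open import Relation.Binary.PropositionalEquality
  using (_≡_; _≢_; refl; sym; trans; cong; subst; subst-sym-subst)
open import Relation.Nullary using (¬_; yes; no)
open import Relation.Nullary.Decidable using (map′; dec⇒maybe; decidable-stable)

-- Excluded middle at a lower level; symmetries of sides and roles.

lowerExcludedMiddle : ∀ {a} b → ExcludedMiddle (a ⊔ b) → ExcludedMiddle a
lowerExcludedMiddle b em = map′ (lower {ℓ = b}) lift em

opp-involutive : ∀ k → opp (opp k) ≡ k
opp-involutive left  = refl
opp-involutive right = refl

k≢opp-k : ∀ {k} → k ≢ opp k
k≢opp-k {left}  ()
k≢opp-k {right} ()

same⊎opposite : ∀ k s → k ≡ s ⊎ k ≡ opp s
same⊎opposite left  left  = inj₁ refl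
same⊎opposite left  right = inj₂ refl
same⊎opposite right left  = inj₂ refl
same⊎opposite right right = inj₁ refl

side-opponent : ∀ P → side (opponent P) ≡ opp (side P)
side-opponent LI  = refl
side-opponent LII = refl
side-opponent RI  = refl
side-opponent RII = refl

starter-opponent : ∀ P → starter (opponent P) ≡ starter P
starter-opponent LI  = refl
starter-opponent LII = refl
starter-opponent RI  = refl
starter-opponent RII = refl

opponent-involutive : ∀ P → opponent (opponent P) ≡ P
opponent-involutive LI  = refl
opponent-involutive LII = refl
opponent-involutive RI  = refl
opponent-involutive RII = refl

module Determinacy {ℓ : Level} (em : ExcludedMiddle (suc ℓ)) (ac : AxiomOfChoice ℓ (suc ℓ))
                   (𝓗 : FinalCoalgebra ℓ) where

  open Hypergames 𝓗
  open Coalgebra (proj₁ 𝓗) using (str-cong)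
    renaming (refl to ≈-refl; sym to ≈-sym; trans to ≈-trans)

  private
    variable
      k s      : Side
      x x′ y z : Hypergame
      xs ys zs : List Hypergame
      π        : Sequence

  em₀ : ExcludedMiddle ℓ
  em₀ = lowerExcludedMiddle (suc ℓ) em

  options-resp-≈ : ∀ k → x ≈ x′ → y ∈ options k x → y ∈ options k x′
  options-resp-≈ left  e (i , p) = let (j , q) = proj₁ (proj₁ (str-cong e)) i in j , ≈-trans p q
  options-resp-≈ right e (i , p) = let (j , q) = proj₁ (proj₂ (str-cong e)) i in j , ≈-trans p q

  -- Prefixes of plays

  _≤ₚ_ : List Hypergame → List Hypergame → Set (suc ℓ)
  _≤ₚ_ = Prefix _≈_

  Pointwise-refl : Pointwise _≈_ xs xs
  Pointwise-refl = Pointwise.refl ≈-refl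

  Prefix-refl : xs ≤ₚ xs
  Prefix-refl = Prefix.fromPointwise Pointwise-refl

  Prefix-init : ∀ xs → xs ≤ₚ (xs ∷ʳ y)
  Prefix-init []       = []
  Prefix-init (_ ∷ xs) = ≈-refl ∷ Prefix-init xs

  Prefix-∷ʳ-last : ∀ xs → (xs ∷ʳ y) ≤ₚ (xs ∷ʳ z) → y ≈ z
  Prefix-∷ʳ-last []       (e ∷ _) = e
  Prefix-∷ʳ-last (_ ∷ xs) (_ ∷ p) = Prefix-∷ʳ-last xs p

  ∷ʳ-Prefix-∷ʳ : ∀ xs ys → (xs ∷ʳ y) ≤ₚ (ys ∷ʳ z) → (xs ∷ʳ y) ≤ₚ ys ⊎ Pointwise _≈_ xs ys
  ∷ʳ-Prefix-∷ʳ []           []       _       = inj₂ []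
  ∷ʳ-Prefix-∷ʳ []           (_ ∷ _)  (e ∷ _) = inj₁ (e ∷ [])
  ∷ʳ-Prefix-∷ʳ (_ ∷ [])     []       (_ ∷ ())
  ∷ʳ-Prefix-∷ʳ (_ ∷ _ ∷ _)  []       (_ ∷ ())
  ∷ʳ-Prefix-∷ʳ (_ ∷ xs)     (_ ∷ ys) (e ∷ p) with ∷ʳ-Prefix-∷ʳ xs ys p
  ... | inj₁ q = inj₁ (e ∷ q)
  ... | inj₂ q = inj₂ (e ∷ q)

  Prefix-split : xs ≤ₚ ys → Pointwise _≈_ ys xs ⊎ ∃[ y ] (xs ∷ʳ y) ≤ₚ ys
  Prefix-split {ys = []}    []      = inj₁ []
  Prefix-split {ys = _ ∷ _} []      = inj₂ (_ , ≈-refl ∷ [])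
  Prefix-split              (e ∷ p) with Prefix-split p
  ... | inj₁ q       = inj₁ (≈-sym e ∷ q)
  ... | inj₂ (y , q) = inj₂ (y , e ∷ q)

  applyUpTo-⊑ : ∀ (f : ℕ → Hypergame) n → applyUpTo f n ⊑ inf f
  applyUpTo-⊑ f n = subst (λ m → Pointwise _≈_ (applyUpTo f n) (applyUpTo f m))
                          (sym (length-applyUpTo f n)) Pointwise-refl

  ⊑-resp-Prefix : ∀ π → xs ≤ₚ ys → ys ⊑ π → xs ⊑ π
  ⊑-resp-Prefix (fin _) p       q       = Prefix.trans ≈-trans p q
  ⊑-resp-Prefix (inf _) []      _       = []
  ⊑-resp-Prefix (inf f) (e ∷ p) (d ∷ q) = ≈-trans e d ∷ ⊑-resp-Prefix (inf (f ∘ ℕ.suc)) p q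

  ⊑-chain : ∀ π → xs ⊑ π → ys ⊑ π → length xs ≤ length ys → xs ≤ₚ ys
  ⊑-chain {xs = []}    _             _       _       _       = []
  ⊑-chain {xs = _ ∷ _} (fin (_ ∷ π)) (e ∷ p) (d ∷ q) (s≤s l) = ≈-trans e (≈-sym d) ∷ ⊑-chain (fin π) p q l
  ⊑-chain {xs = _ ∷ _} (inf f)       (e ∷ p) (d ∷ q) (s≤s l) = ≈-trans e (≈-sym d) ∷ ⊑-chain (inf (f ∘ ℕ.suc)) p q l

  isFinitePlay-prefix : x ≈ x′ → xs ≤ₚ ys → IsFinitePlay k x ys → IsFinitePlay k x′ xs
  isFinitePlay-prefix _ []      _ = []
  isFinitePlay-prefix {k = k} d (e ∷ p) ((i , q) ∷ r) =
    options-resp-≈ k d (i , ≈-trans e q) ∷ isFinitePlay-prefix (≈-sym e) p r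

  isPlay-prefix : ∀ π → IsPlay k x π → xs ⊑ π → IsFinitePlay k x xs
  isPlay-prefix (fin _) r p = isFinitePlay-prefix ≈-refl p r
  isPlay-prefix (inf _) r p = isFinitePlay-prefix ≈-refl (Prefix.fromPointwise p) (r _)

  lastMove : ∀ ys → IsFinitePlay k x (ys ∷ʳ y) → y ∈ options (toMove k ys) (finalPosition x ys)
  lastMove []       (p ∷ _) = p
  lastMove (_ ∷ ys) (_ ∷ r) = lastMove ys r

  extend : IsFinitePlay k x ys → y ∈ options (toMove k ys) (finalPosition x ys) →
           IsFinitePlay k x (ys ∷ʳ y)
  extend []      p = p ∷ []
  extend (q ∷ r) p = q ∷ extend r p

  toMove-cong : ∀ k → Pointwise _≈_ xs ys → toMove k xs ≡ toMove k ys
  toMove-cong k []      = refl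
  toMove-cong k (_ ∷ p) = toMove-cong (opp k) p

  -- Enumeration of the options without repetition

  module _ (X : 𝒫 ℓ Hypergame) where

    private
      discrete kernel : Setoid ℓ (suc ℓ)
      discrete = record
        { Carrier       = proj₁ X
        ; _≈_           = λ i j → Lift (suc ℓ) (i ≡ j)
        ; isEquivalence = record
          { refl  = lift refl
          ; sym   = λ (lift p) → lift (sym p)
          ; trans = λ (lift p) (lift q) → lift (trans p q)
          }
        }
      kernel = record
        { Carrier       = proj₁ X
        ; _≈_           = λ i j → proj₂ X i ≈ proj₂ X j
        ; isEquivalence = record { refl = ≈-refl ; sym = ≈-sym ; trans = ≈-trans }
        }

      -- The identity on indices is a surjection from the indices up to `≡` to the indices up to
      -- equality of their options. A section respects equality, so it sends all indices of equal
      -- options to one index.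
      section = ac discrete kernel record
        { to         = λ i → i
        ; cong       = λ { (lift refl) → ≈-refl }
        ; surjective = λ i → i , λ { (lift refl) → ≈-refl }
        }

    canonical : proj₁ X → proj₁ X
    canonical = Func.to (proj₁ section)

    canonical-≈ : ∀ i → proj₂ X (canonical i) ≈ proj₂ X i
    canonical-≈ = proj₂ section

    canonical-cong : ∀ {i j} → proj₂ X i ≈ proj₂ X j → canonical i ≡ canonical j
    canonical-cong p = lower (Func.cong (proj₁ section) p)

    -- The fixed points of `canonical` hold exactly one index for each option: `canonical` is
    -- idempotent because `canonical i` carries an option equal to that of `i`.
    distinct : 𝒫 ℓ Hypergame
    distinct = (Σ[ i ∈ proj₁ X ] canonical i ≡ i) , proj₂ X ∘ proj₁

    ∈-distinct : y ∈ X → y ∈ distinct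
    ∈-distinct (i , p) = (canonical i , canonical-cong (canonical-≈ i)) , ≈-trans p (≈-sym (canonical-≈ i))

    distinct-injective : ∀ i j → proj₂ distinct i ≈ proj₂ distinct j → i ≡ j
    distinct-injective (i , p) (j , q) e with refl ← trans (sym p) (trans (canonical-cong e) q) =
      cong (i ,_) (uip p q)

  record Move (k : Side) (z : Hypergame) : Set ℓ where
    constructor mkMove
    field index : proj₁ (distinct (options k z))

  result : Move k z → Hypergame
  result {k} {z} (mkMove i) = proj₂ (distinct (options k z)) i

  result-∈ : (m : Move k z) → result m ∈ options k z
  result-∈ (mkMove (i , _)) = i , ≈-refl

  result-injective : (m n : Move k z) → result m ≈ result n → m ≡ n
  result-injective {k} {z} (mkMove i) (mkMove j) e = cong mkMove (distinct-injective (options k z) i j e)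

  -- Kept abstract so that its calls inside `run` can be generalised by `with`.
  abstract
    locate : z ≈ x → y ∈ options k x → Σ[ m ∈ Move k z ] (y ≈ result m)
    locate {z} {k = k} e p =
      let (i , q) = ∈-distinct (options k z) (options-resp-≈ k (≈-sym e) p) in mkMove i , q

  -- The play generated by a rule for both sides

  record Profile (k : Side) (x : Hypergame) : Set (suc ℓ) where
    field
      next      : IsFinitePlay k x ys → Maybe Hypergame
      next-cong : (r : IsFinitePlay k x xs) (r′ : IsFinitePlay k x ys) → Pointwise _≈_ xs ys →
                  Maybe.Pointwise _≈_ (next r) (next r′)
      legal     : (r : IsFinitePlay k x ys) → next r ≡ just y → IsFinitePlay k x (ys ∷ʳ y)
      defined   : (r : IsFinitePlay k x ys) → IsFinitePlay k x (ys ∷ʳ y) → Is-just (next r)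

  Complete : Side → Hypergame → Sequence → Set (suc ℓ)
  Complete k x (fin ys) = ∀ y → ¬ IsFinitePlay k x (ys ∷ʳ y)
  Complete k x (inf _)  = ⊤

  -- A finite play without legal continuation has no longer play above it, finite or infinite; an
  -- infinite play is never below a finite one; infinite plays one below the other agree at every
  -- length.
  complete-maximal : ∀ π ρ → Complete k x π → IsPlay k x ρ → π ≼ ρ → ρ ≼ π
  complete-maximal (fin ys) (fin zs) c r le xs p with Prefix-split (le ys Prefix-refl)
  ... | inj₁ q       = Prefix.trans ≈-trans p (Prefix.fromPointwise q)
  ... | inj₂ (y , q) = ⊥-elim (c y (isFinitePlay-prefix ≈-refl q r))
  complete-maximal {k} {x} (fin ys) (inf f) c r le xs p =
    ⊥-elim (c (f n) (isFinitePlay-prefix ≈-refl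
      (Prefix.++⁺ (le ys Prefix-refl) Prefix-refl)
      (subst (IsFinitePlay k x) (sym (applyUpTo-∷ʳ f n)) (r (ℕ.suc n)))))
    where n = length ys
  complete-maximal (inf f) (fin zs) c r le xs p =
    ⊥-elim (1+n≰n (subst (_≤ length zs) (length-applyUpTo f (ℕ.suc n))
                   (Prefix.length-mono (le (applyUpTo f (ℕ.suc n)) (applyUpTo-⊑ f (ℕ.suc n))))))
    where n = length zs
  complete-maximal (inf f) (inf g) c r le xs p =
    ⊑-resp-Prefix (inf f)
      (⊑-chain (inf g) p (le (applyUpTo f n) (applyUpTo-⊑ f n)) (≤-reflexive (sym (length-applyUpTo f n))))
      (applyUpTo-⊑ f n)
    where n = length xs

  module _ (φ : Profile k x) where

    open Profile φ

    Follows : Sequence → Set (suc ℓ)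
    Follows π = ∀ {ys y} (r : IsFinitePlay k x ys) → ys ⊏ π → next r ≡ just y → (ys ∷ʳ y) ⊑ π

    data Played : List Hypergame → Set (suc ℓ) where
      start : Played []
      play  : Played ys → (r : IsFinitePlay k x ys) → next r ≡ just y → Played (ys ∷ʳ y)

    played-isPlay : Played ys → IsFinitePlay k x ys
    played-isPlay start         = []
    played-isPlay (play d r eq) = legal r eq

    next-unique : (r : IsFinitePlay k x xs) (r′ : IsFinitePlay k x ys) → Pointwise _≈_ xs ys →
                  next r ≡ just y → next r′ ≡ just z → y ≈ z
    next-unique r r′ p eq eq′ with next r | next r′ | next-cong r r′ p | eq | eq′
    ... | _ | _ | Maybe.just e | refl | refl = e

    -- A list lying properly below `ys ∷ʳ y` either lies properly below `ys`, where induction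
    -- applies, or equals `ys`, where `next-unique` identifies the two replies.
    played-follows : Played ys → Follows (fin ys)
    played-follows start           []      (_ , ()) _
    played-follows start           (_ ∷ _) (_ , ()) _
    played-follows (play {ys} d r eq) {zs} r′ (w , p) eq′ with ∷ʳ-Prefix-∷ʳ zs ys p
    ... | inj₁ q = Prefix.trans ≈-trans (played-follows d r′ (w , q) eq′) (Prefix-init ys)
    ... | inj₂ q = Prefix.++⁺ q (next-unique r′ r q eq′ eq ∷ [])

    module _ (unbounded : ∀ {ys} → Played ys → (r : IsFinitePlay k x ys) → next r ≢ nothing) where

      private
        nextMove : Played ys → ∃[ y ] Played (ys ∷ʳ y)
        nextMove d with next (played-isPlay d) in eq
        ... | just y  = y , play d (played-isPlay d) eq
        ... | nothing = ⊥-elim (unbounded d (played-isPlay d) eq)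

        stage : ℕ → ∃[ ys ] Played ys
        stage zero      = [] , start
        stage (ℕ.suc n) = _ , proj₂ (nextMove (proj₂ (stage n)))

      stream : ℕ → Hypergame
      stream n = proj₁ (nextMove (proj₂ (stage n)))

      stream-played : ∀ n → Played (applyUpTo stream n)
      stream-played n = subst Played (sym (upTo n)) (proj₂ (stage n))
        where
        upTo : ∀ n → applyUpTo stream n ≡ proj₁ (stage n)
        upTo zero      = refl
        upTo (ℕ.suc n) = trans (sym (applyUpTo-∷ʳ stream n)) (cong (_∷ʳ stream n) (upTo n))

      stream-follows : Follows (inf stream)
      stream-follows {ys} r (w , p) eq =
        ⊑-resp-Prefix (inf stream)
          (played-follows (stream-played n) r (w , Prefix.fromPointwise p) eq)
          (applyUpTo-⊑ stream n)
        where n = length (ys ∷ʳ w)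

    -- Excluded middle decides whether iterating `next` from the empty play ever yields `nothing`.
    -- If it does, `defined` shows that the play reached has no continuation; otherwise the
    -- iteration gives an infinite play.
    generatedPlay : ∃[ π ] (IsPlay k x π × Follows π × Complete k x π)
    generatedPlay with em {∃[ ys ] (Played ys × Σ[ r ∈ IsFinitePlay k x ys ] next r ≡ nothing)}
    ... | yes (ys , d , r , eq) =
      fin ys , r , played-follows d , λ y r′ → ¬Is-just-nothing (subst Is-just eq (defined r r′))
      where
      ¬Is-just-nothing : ¬ Is-just {A = Hypergame} nothing
      ¬Is-just-nothing ()
    ... | no ¬stuck =
      inf stream′ , (λ n → played-isPlay (stream-played unbounded n)) , stream-follows unbounded , tt
      where
      unbounded : ∀ {ys} → Played ys → (r : IsFinitePlay k x ys) → next r ≢ nothing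
      unbounded d r eq = ¬stuck (_ , d , r , eq)
      stream′ = stream unbounded

  -- The outcome of two opposing strategies.

  module _ {P : Role} (f : Strategy x P) (f′ : Strategy x (opponent P)) where

    private
      Q = opponent P

      own : (r : IsFinitePlay (starter P) x ys) → toMove (starter P) ys ≡ side P → FPlay P x
      own {ys} r t = record { moves = ys ; isPlay = r ; turn = t }

      other : (r : IsFinitePlay (starter P) x ys) → toMove (starter P) ys ≡ opp (side P) → FPlay Q x
      other {ys} r t = record
        { moves  = ys
        ; isPlay = subst (λ k → IsFinitePlay k x ys) (sym (starter-opponent P)) r
        ; turn   = trans (cong (λ k → toMove k ys) (starter-opponent P)) (trans t (sym (side-opponent P)))
        }

      reply : (r : IsFinitePlay (starter P) x ys) →
              toMove (starter P) ys ≡ side P ⊎ toMove (starter P) ys ≡ opp (side P) → Maybe Hypergame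
      reply r (inj₁ t) = move f (own r t)
      reply r (inj₂ t) = move f′ (other r t)

      toPlay : IsFinitePlay (starter Q) x ys → IsFinitePlay (starter P) x ys
      toPlay {ys} = subst (λ k → IsFinitePlay k x ys) (starter-opponent P)

      fromPlay : IsFinitePlay (starter P) x ys → IsFinitePlay (starter Q) x ys
      fromPlay {ys} = subst (λ k → IsFinitePlay k x ys) (sym (starter-opponent P))

    merge : Profile (starter P) x
    merge = record
      { next      = λ {ys} r → reply r (turnOf ys)
      ; next-cong = λ {xs} {ys} r r′ p → reply-cong r r′ p (turnOf xs) (turnOf ys)
      ; legal     = λ {ys} r → reply-legal r (turnOf ys)
      ; defined   = λ {ys} r → reply-defined r (turnOf ys)
      }
      where
      turnOf : ∀ ys → toMove (starter P) ys ≡ side P ⊎ toMove (starter P) ys ≡ opp (side P)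
      turnOf ys = same⊎opposite (toMove (starter P) ys) (side P)

      reply-cong : (r : IsFinitePlay (starter P) x xs) (r′ : IsFinitePlay (starter P) x ys) →
                   Pointwise _≈_ xs ys → ∀ t t′ → Maybe.Pointwise _≈_ (reply r t) (reply r′ t′)
      reply-cong r r′ p (inj₁ t) (inj₁ t′) = Strategy.cong f _ _ p
      reply-cong r r′ p (inj₂ t) (inj₂ t′) = Strategy.cong f′ _ _ p
      reply-cong r r′ p (inj₁ t) (inj₂ t′) =
        ⊥-elim (k≢opp-k (trans (sym t) (trans (toMove-cong (starter P) p) t′)))
      reply-cong r r′ p (inj₂ t) (inj₁ t′) =
        ⊥-elim (k≢opp-k (trans (sym t′) (trans (sym (toMove-cong (starter P) p)) t)))

      reply-legal : (r : IsFinitePlay (starter P) x ys) → ∀ t → reply r t ≡ just y →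
                    IsFinitePlay (starter P) x (ys ∷ʳ y)
      reply-legal r (inj₁ t) eq = Strategy.legal f _ _ eq
      reply-legal r (inj₂ t) eq = toPlay (Strategy.legal f′ _ _ eq)

      reply-defined : (r : IsFinitePlay (starter P) x ys) → ∀ t →
                      IsFinitePlay (starter P) x (ys ∷ʳ y) → Is-just (reply r t)
      reply-defined r (inj₁ t) r′ = Strategy.defined f _ _ r′
      reply-defined r (inj₂ t) r′ = Strategy.defined f′ _ _ (fromPlay r′)

    -- The test of whose turn it is may return another proof than the one stored in `ρ`; uniqueness
    -- of identity proofs identifies the two.
    merge-own : (ρ : FPlay P x) → Profile.next merge (isPlay ρ) ≡ move f ρ
    merge-own ρ with same⊎opposite (toMove (starter P) (moves ρ)) (side P)
    ... | inj₁ t = cong (λ t → move f (own (isPlay ρ) t)) (uip t (turn ρ))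
    ... | inj₂ t = ⊥-elim (k≢opp-k (trans (sym (turn ρ)) t))

    merge-other : (ρ : FPlay Q x) → Profile.next merge (toPlay (isPlay ρ)) ≡ move f′ ρ
    merge-other ρ with same⊎opposite (toMove (starter P) (moves ρ)) (side P)
    ... | inj₁ t = ⊥-elim (k≢opp-k (trans (sym t) (trans
                     (cong (λ k → toMove k (moves ρ)) (sym (starter-opponent P)))
                     (trans (turn ρ) (side-opponent P)))))
    ... | inj₂ t = trans
      (cong (λ t → move f′ (record { moves = moves ρ ; isPlay = fromPlay (toPlay (isPlay ρ)) ; turn = t }))
            (uip _ (turn ρ)))
      (cong (λ r → move f′ (record { moves = moves ρ ; isPlay = r ; turn = turn ρ }))
            (subst-sym-subst (starter-opponent P)))

    outcome : ∃[ π ] (IsOutcome f f′ π × Complete (starter P) x π)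
    outcome =
      let (π , r , follows , complete) = generatedPlay merge in
      π , record
        { isPlay    = r
        ; coherent  = λ ρ y p eq → follows (isPlay ρ) p (trans (merge-own ρ) eq)
        ; coherent′ = λ ρ y p eq → follows (toPlay (isPlay ρ)) p (trans (merge-other ρ) eq)
        ; maximal   = λ ρ r′ _ _ → complete-maximal π ρ complete r′
        } , complete

  -- Strategies obtained from an invariant of the positions

  -- `Inv k z` speaks of position `z` with side `k` to move. Side `s` always has a move that keeps
  -- the invariant, and the other side cannot break it; this shape covers both winning and
  -- non-losing play.
  record Plan (s : Side) : Set (suc ℓ) where
    field
      Inv   : Side → Hypergame → Set ℓ
      own   : k ≡ s → Inv k z → Σ[ m ∈ Move k z ] Inv (opp k) (result m)
      other : k ≡ opp s → Inv k z → (m : Move k z) → Inv (opp k) (result m)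

  module Planned {s : Side} (plan : Plan s) where

    open Plan plan

    -- The memory is empty once the strategy's own side has deviated from the plan.
    Memory : Side → Hypergame → Set ℓ
    Memory k z = Maybe (Inv k z)

    -- Where the plan gives no move, excluded middle picks any existing one, since a strategy must
    -- be defined at every play that can be continued.
    choose : Memory k z → Maybe (Move k z)
    choose nothing = dec⇒maybe em₀
    choose {k} (just v) with same⊎opposite k s
    ... | inj₁ e = just (proj₁ (own e v))
    ... | inj₂ _ = dec⇒maybe em₀

    choose-defined : (q : Memory k z) → Move k z → Is-just (Maybe.map result (choose q))
    choose-defined {k} {z} nothing m with em₀ {Move k z}
    ... | yes _ = Any.just _
    ... | no ¬m = ⊥-elim (¬m m)
    choose-defined {k} {z} (just v) m with same⊎opposite k s
    ... | inj₁ e = Any.just _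
    ... | inj₂ _ with em₀ {Move k z}
    ...   | yes _ = Any.just _
    ...   | no ¬m = ⊥-elim (¬m m)

    update : Memory k z → (m : Move k z) → Memory (opp k) (result m)
    update nothing m = nothing
    update {k} (just v) m with same⊎opposite k s
    ... | inj₂ e = just (other e v m)
    ... | inj₁ e with em₀ {proj₁ (own e v) ≡ m}
    ...   | yes refl = just (proj₂ (own e v))
    ...   | no _     = nothing

    -- Side and position are bundled with the memory, so that runs along different plays can be
    -- compared by `≡`.
    record Config : Set (suc ℓ) where
      constructor config
      field
        {active}   : Side
        {position} : Hypergame
        memory     : Memory active position

    open Config

    after : (c : Config) → Move (active c) (position c) → Config
    after c m = config (update (memory c) m)

    -- The run tracks the position `z` named by the enumeration, which is only `≈` to the position
    -- `x` of the play; thus the invariant is never transported along `≈`.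
    run : z ≈ x → Memory k z → IsFinitePlay k x ys → Config
    run e q []      = config q
    run e q (p ∷ r) = let (m , d) = locate e p in run (≈-sym d) (update q m) r

    run-active : (e : z ≈ x) (q : Memory k z) (r : IsFinitePlay k x ys) → active (run e q r) ≡ toMove k ys
    run-active e q []      = refl
    run-active e q (_ ∷ r) = run-active _ _ r

    run-position : (e : z ≈ x) (q : Memory k z) (r : IsFinitePlay k x ys) →
                   position (run e q r) ≈ finalPosition x ys
    run-position e q []      = e
    run-position e q (_ ∷ r) = run-position _ _ r

    -- Equal moves have the same index by `result-injective`, so the runs are identical and not
    -- merely equal up to `≈`. This is why the strategy respects equality of plays.
    run-cong : (e : z ≈ x) (e′ : z ≈ x′) (q : Memory k z)
               (r : IsFinitePlay k x xs) (r′ : IsFinitePlay k x′ ys) →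
               Pointwise _≈_ xs ys → run e q r ≡ run e′ q r′
    run-cong e e′ q []      []        []      = refl
    run-cong {k = k} e e′ q (p ∷ r) (p′ ∷ r′) (d ∷ ds) with locate {k = k} e p | locate {k = k} e′ p′
    ... | m , a | m′ , a′ with refl ← result-injective m m′ (≈-trans (≈-sym a) (≈-trans d a′)) =
      run-cong _ _ _ r r′ ds

    run-∷ʳ : (e e′ : z ≈ x) (q : Memory k z)
             (r : IsFinitePlay k x ys) (r′ : IsFinitePlay k x (ys ∷ʳ y)) →
             ∃[ m ] (run e′ q r′ ≡ after (run e q r) m × y ≈ result m)
    run-∷ʳ e e′ q []      (p ∷ [])  = let (m , d) = locate e′ p in m , refl , d
    run-∷ʳ {k = k} e e′ q (p ∷ r) (p′ ∷ r′) with locate {k = k} e p | locate {k = k} e′ p′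
    ... | m , d | m′ , d′ with refl ← result-injective m m′ (≈-trans (≈-sym d) d′) =
      run-∷ʳ (≈-sym d) (≈-sym d′) (update q m) r r′

    record Point : Set (suc ℓ) where
      constructor point
      field
        {active}   : Side
        {position} : Hypergame
        invariant  : Inv active position

    live : Point → Config
    live (point v) = config (just v)

    -- One move on plan, read backwards: well-foundedness says that play on plan cannot go on
    -- forever.
    data _≺_ : Point → Point → Set (suc ℓ) where
      own-move   : (e : k ≡ s) (v : Inv k z) → point (proj₂ (own e v)) ≺ point v
      other-move : (e : k ≡ opp s) (v : Inv k z) (m : Move k z) → point (other e v m) ≺ point v

    after-live : (v : Inv k z) (m : Move k z) →
                 (∀ m′ → k ≡ s → choose (just v) ≡ just m′ → m′ ≡ m) →
                 ∃[ p ] (after (live (point v)) m ≡ live p × p ≺ point v)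
    after-live {k} v m chosen with same⊎opposite k s
    ... | inj₂ e = _ , refl , other-move e v m
    ... | inj₁ e with em₀ {proj₁ (own e v) ≡ m}
    ...   | yes refl = _ , refl , own-move e v
    ...   | no m₀≢m  = ⊥-elim (m₀≢m (chosen _ e refl))

    respond : Config → Maybe Hypergame
    respond c = Maybe.map result (choose (memory c))

    respond-∈ : ∀ c → respond c ≡ just y → y ∈ options (active c) (position c)
    respond-∈ c eq with choose (memory c) | eq
    ... | just m  | refl = result-∈ m

    module _ {P : Role} (P≡s : side P ≡ s) (v : Inv (starter P) x) where

      runFrom : IsFinitePlay (starter P) x ys → Config
      runFrom = run ≈-refl (just v)

      strategy : Strategy x P
      strategy = record
        { move    = λ ρ → respond (runFrom (isPlay ρ))
        ; cong    = λ π ρ p → Maybe.reflexive (λ { refl → ≈-refl })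
                                (cong respond (run-cong ≈-refl ≈-refl (just v) (isPlay π) (isPlay ρ) p))
        ; legal   = λ ρ y eq → legal (isPlay ρ) (respond-∈ (runFrom (isPlay ρ)) eq)
        ; defined = λ ρ y r → choose-defined (memory (runFrom (isPlay ρ))) (moveAt (isPlay ρ) r)
        }
        where
        legal : (r : IsFinitePlay (starter P) x ys) →
                y ∈ options (active (runFrom r)) (position (runFrom r)) →
                IsFinitePlay (starter P) x (ys ∷ʳ y)
        legal {ys} {y} r p = extend r
          (options-resp-≈ (toMove (starter P) ys) (run-position ≈-refl (just v) r)
            (subst (λ l → y ∈ options l (position (runFrom r))) (run-active ≈-refl (just v) r) p))

        moveAt : (r : IsFinitePlay (starter P) x ys) → IsFinitePlay (starter P) x (ys ∷ʳ y) →
                 Move (active (runFrom r)) (position (runFrom r))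
        moveAt {ys} {y} r r′ = proj₁ (locate (run-position _ _ r)
          (subst (λ l → y ∈ options l (finalPosition x ys)) (sym (run-active _ _ r)) (lastMove ys r′)))

      module _ (π : Sequence) (π-isPlay : IsPlay (starter P) x π) (coherent : Coherent strategy π) where

        -- On an own turn coherence forces the move in `π` to be `≈` to the chosen one; injectivity
        -- of the enumeration makes them identical, so the memory survives and the point descends.
        run-step : (r : IsFinitePlay (starter P) x ys) (r′ : IsFinitePlay (starter P) x (ys ∷ʳ y)) →
                   (ys ∷ʳ y) ⊑ π → ∀ p → runFrom r ≡ live p →
                   ∃[ p′ ] (runFrom r′ ≡ live p′ × p′ ≺ p)
        run-step {ys} {y} r r′ ys∷ʳy⊑π (point {k} v′) eq
          with runFrom r in run-r | run-∷ʳ ≈-refl ≈-refl (just v) r r′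
        run-step {ys} {y} r r′ ys∷ʳy⊑π (point {k} v′) refl | _ | m , eq , y≈m =
          let (p′ , eq′ , p′≺p) = after-live v′ m chosen in p′ , trans eq eq′ , p′≺p
          where
          chosen : ∀ m′ → k ≡ s → choose (just v′) ≡ just m′ → m′ ≡ m
          chosen m′ k≡s eq′ = result-injective m′ m (≈-trans (≈-sym y≈m′) y≈m)
            where
            ρ : FPlay P x
            ρ = record
              { moves = ys ; isPlay = r
              ; turn = trans (sym (run-active ≈-refl (just v) r)) (trans (cong active run-r) (trans k≡s (sym P≡s)))
              }

            follows : (ys ∷ʳ result m′) ⊑ π
            follows = coherent ρ (result m′) (y , ys∷ʳy⊑π)
              (trans (cong respond run-r) (cong (Maybe.map result) eq′))

            y≈m′ : y ≈ result m′
            -- Both one-move extensions of `ys` are prefixes of `π` of the same length.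
            y≈m′ = Prefix-∷ʳ-last ys (⊑-chain π ys∷ʳy⊑π follows
              (≤-reflexive (trans (length-++ ys) (sym (length-++ ys)))))

        -- Induction removes the last move, because `run-step` extends a play at its end.
        run-live : Reverse ys → ys ⊑ π → (r : IsFinitePlay (starter P) x ys) → ∃[ p ] (runFrom r ≡ live p)
        run-live []             _ [] = _ , refl
        run-live (ys ∶ rs ∶ʳ y) l r =
          let l′ = ⊑-resp-Prefix π (Prefix-init ys) l
              r₀ = isPlay-prefix π π-isPlay l′
              (p , eq) = run-live rs l′ r₀
              (p′ , eq′ , _) = run-step r₀ r l p eq
          in p′ , eq′

        -- The plan is still live here and supplies a move, which is carried over from the tracked
        -- position to the actual one.
        own-unstuck : (r : IsFinitePlay (starter P) x ys) → ys ⊑ π → toMove (starter P) ys ≡ s →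
                      ∃[ y ] (y ∈ options (toMove (starter P) ys) (finalPosition x ys))
        own-unstuck {ys} r l t
          with runFrom r | run-live (reverseView ys) l r
             | run-active ≈-refl (just v) r | run-position ≈-refl (just v) r
        ... | _ | point v′ , refl | k≡ | z≈ =
          let (m , _) = own (trans k≡ t) v′ in
          result m , options-resp-≈ (toMove (starter P) ys) z≈ (subst (λ l → result m ∈ options l _) k≡ (result-∈ m))

      -- The points met after 0, 1, 2, ... moves would form an infinite descending chain for `≺`.
      no-infinite-play : WellFounded _≺_ → ∀ g → IsPlay (starter P) x (inf g) → ¬ Coherent strategy (inf g)
      no-infinite-play wf g g-isPlay coherent =
        descend 0 _ (wf _) (proj₂ (run-live (inf g) g-isPlay coherent [] [] (g-isPlay 0)))
        where
        descend : ∀ n p → Acc _≺_ p → ¬ runFrom (g-isPlay n) ≡ live p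
        descend n p (acc rs) eq =
          let r′ = subst (IsFinitePlay (starter P) x) (sym (applyUpTo-∷ʳ g n)) (g-isPlay (ℕ.suc n))
              l = subst (_⊑ inf g) (sym (applyUpTo-∷ʳ g n)) (applyUpTo-⊑ g (ℕ.suc n))
              (p′ , eq′ , p′≺p) = run-step (inf g) g-isPlay coherent (g-isPlay n) r′ l p eq
          in descend (ℕ.suc n) p′ (rs p′≺p)
               -- `r′` and `g-isPlay (ℕ.suc n)` concern the same moves, written as an extension of
               -- the first `n` or listed at once; `run-cong` identifies their runs.
               (trans (run-cong ≈-refl ≈-refl (just v) (g-isPlay (ℕ.suc n)) r′
                        (subst (Pointwise _≈_ _) (sym (applyUpTo-∷ʳ g n)) Pointwise-refl)) eq′)

      finite-winning : ∀ ys → IsFinitePlay (starter P) x ys → Coherent strategy (fin ys) →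
                       Complete (starter P) x (fin ys) → WinningPlay (side P) (starter P) x (fin ys)
      finite-winning ys r coherent complete with same⊎opposite (toMove (starter P) ys) s
      ... | inj₁ t =
        let (y , p) = own-unstuck (fin ys) r coherent r Prefix-refl t in ⊥-elim (complete y (extend r p))
      ... | inj₂ t =
        let t′ = trans t (cong opp (sym P≡s)) in
        t′ , λ y p → complete y (extend r (subst (λ l → y ∈ options l (finalPosition x ys)) (sym t′) p))

      strategy-nonLosing : NonLosing strategy
      strategy-nonLosing f′ with outcome strategy f′
      ... | inf g  , o , _        = inf g , o , inj₂ tt
      ... | fin ys , o , complete =
        fin ys , o , inj₁ (finite-winning ys (IsOutcome.isPlay o) (IsOutcome.coherent o) complete)

      strategy-winning : WellFounded _≺_ → Winning strategy
      strategy-winning wf f′ with outcome strategy f′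
      ... | inf g  , o , _        = ⊥-elim (no-infinite-play wf g (IsOutcome.isPlay o) (IsOutcome.coherent o))
      ... | fin ys , o , complete =
        fin ys , o , finite-winning ys (IsOutcome.isPlay o) (IsOutcome.coherent o) complete

      -- Stated for a single coherent play, so that it applies to an outcome in which this strategy
      -- appears as the opponent's.
      not-nonLosing-for-opponent : WellFounded _≺_ → ∀ π → IsPlay (starter P) x π → Coherent strategy π →
                                   ¬ NonLosingPlay (opp s) (starter P) x π
      not-nonLosing-for-opponent wf (inf g)  r coherent _ = no-infinite-play wf g r coherent
      not-nonLosing-for-opponent wf (fin ys) r coherent (inj₁ (t , stuck)) =
        let (y , p) = own-unstuck (fin ys) r coherent r Prefix-refl (trans t (opp-involutive s))
        in stuck y (subst (λ l → y ∈ options l (finalPosition x ys)) t p)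

  -- Positions won for a side, and the two plans.

  data Win (s k : Side) (z : Hypergame) : Set ℓ where
    own   : k ≡ s → (m : Move k z) → Win s (opp k) (result m) → Win s k z
    -- Derivations bottom out here, when the other side has no move.
    other : k ≡ opp s → ((m : Move k z) → Win s (opp k) (result m)) → Win s k z

  winPlan : ∀ s → Plan s
  winPlan s = record
    { Inv   = Win s
    ; own   = λ { e (own _ m w) → m , w ; e (other e′ _) → ⊥-elim (k≢opp-k (trans (sym e) e′)) }
    ; other = λ { e (other _ w) m → w m ; e (own e′ _ _) m → ⊥-elim (k≢opp-k (trans (sym e′) e)) }
    }

  module _ (s : Side) where

    open Planned (winPlan s) using (_≺_; point; own-move; other-move)

    -- Each step of the plan passes to an immediate subderivation, so recursion on the derivation
    -- proves accessibility.
    win-accessible : (w : Win s k z) → Acc _≺_ (point w)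
    win-accessible (own e m w) = acc λ
      { (own-move _ _)      → win-accessible w
      ; (other-move e′ _ _) → ⊥-elim (k≢opp-k (trans (sym e) e′)) }
    win-accessible (other e w) = acc λ
      { (own-move e′ _)     → ⊥-elim (k≢opp-k (trans (sym e′) e))
      ; (other-move _ _ m)  → win-accessible (w m) }

    winPlan-wellFounded : WellFounded _≺_
    winPlan-wellFounded (point w) = win-accessible w

  -- If every own move led to a position won for the other side, then so would be the present one,
  -- by `other`; classically some move escapes. Dually, `own` shows that the other side has no move
  -- to a position won for it.
  escapePlan : ∀ s → Plan s
  escapePlan s = record
    { Inv   = λ k z → ¬ Win (opp s) k z
    ; own   = λ e ¬w → decidable-stable em₀ λ ¬p →
        ¬w (other (trans e (sym (opp-involutive s))) λ m → decidable-stable em₀ λ ¬w′ → ¬p (m , ¬w′))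
    ; other = λ e ¬w m w → ¬w (own e m w)
    }

  -- Determinacy for each role.

  HasNonLosingAs HasWinningAs : Hypergame → Role → Set (suc ℓ)
  HasNonLosingAs x P = Σ (Strategy x P) NonLosing
  HasWinningAs   x P = Σ (Strategy x P) Winning

  winning⇒nonLosing : ∀ {P} → HasWinningAs x P → HasNonLosingAs x P
  winning⇒nonLosing (f , w) = f , λ f′ → let (π , o , v) = w f′ in π , o , inj₁ v

  -- The strategy read off `w` is played against `f`: the outcome is coherent with it, hence cannot
  -- be non-losing for `P`.
  opponent-wins⇒¬nonLosing : ∀ P → Win (side (opponent P)) (starter (opponent P)) x → ¬ HasNonLosingAs x P
  opponent-wins⇒¬nonLosing {x} P w (f , nonLosing) =
    let open Planned (winPlan (side (opponent P)))
        g = strategy refl w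
        (π , o , v) = nonLosing g
    in not-nonLosing-for-opponent refl w (winPlan-wellFounded _) π
         (subst (λ k → IsPlay k x π) (sym (starter-opponent P)) (IsOutcome.isPlay o))
         (IsOutcome.coherent′ o)
         (subst (λ s → NonLosingPlay s (starter (opponent P)) x π) (sym (trans (cong opp (side-opponent P)) (opp-involutive _)))
           (subst (λ k → NonLosingPlay (side P) k x π) (sym (starter-opponent P)) v))

  determined : ∀ x P → HasWinningAs x (opponent P) × ¬ HasNonLosingAs x P ⊎ HasNonLosingAs x P
  determined x P with em₀ {Win (side (opponent P)) (starter (opponent P)) x}
  ... | yes w = let open Planned (winPlan (side (opponent P))) in
    inj₁ ((strategy refl w , strategy-winning refl w (winPlan-wellFounded _)) , opponent-wins⇒¬nonLosing P w)
  ... | no ¬w =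
    let open Planned (escapePlan (side P))
        ¬w′ = λ w → ¬w (subst (λ k → Win (side (opponent P)) k x) (sym (starter-opponent P))
                         (subst (λ s → Win s (starter P) x) (sym (side-opponent P)) w))
    in inj₂ (strategy refl ¬w′ , strategy-nonLosing refl ¬w′)

  Verdict : Hypergame → Role → Set (suc ℓ)
  Verdict x P = HasWinningAs x P × ¬ HasNonLosingAs x (opponent P)
              ⊎ HasWinningAs x (opponent P) × ¬ HasNonLosingAs x P
              ⊎ HasNonLosingAs x P × HasNonLosingAs x (opponent P)

  verdict : ∀ x P → Verdict x P
  verdict x P with determined x P | determined x (opponent P)
  ... | inj₁ opponent-wins | _            = inj₂ (inj₁ opponent-wins)
  ... | inj₂ _             | inj₁ (w , n) = inj₁ (subst (HasWinningAs x) (opponent-involutive P) w , n)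
  ... | inj₂ n             | inj₂ n′      = inj₂ (inj₂ (n , n′))

  -- Classification by the four players.

  TwoNonLosing Balanced Classification : Hypergame → Set (suc ℓ)
  TwoNonLosing x = ∃[ p ] ∃[ q ] (p ≢ q × HasNonLosing x p × HasNonLosing x q)
  Balanced x =
    (ExactlyOneOf (HasNonLosing x L) (HasNonLosing x R) × ExactlyOneOf (HasNonLosing x I) (HasNonLosing x II))
    ⊎ (∀ p → HasNonLosing x p)
  Classification x =
    ((∃[ p ] (HasWinning x p × (∀ q → q ≢ p → ¬ HasWinning x q) × (∀ q → q ≢ p → ¬ HasNonLosing x q)))
     ⊎ TwoNonLosing x)
    × (TwoNonLosing x → Balanced x)

  module _ {x : Hypergame} where

    hasNonLosing : ∀ p → HasNonLosingAs x (proj₁ (roles p)) → HasNonLosingAs x (proj₂ (roles p)) →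
                   HasNonLosing x p
    hasNonLosing p (f , n) (g , n′) = (f , g) , (n , n′)

    asFirst : ∀ p → HasNonLosing x p → HasNonLosingAs x (proj₁ (roles p))
    asFirst p ((f , _) , (n , _)) = f , n

    asSecond : ∀ p → HasNonLosing x p → HasNonLosingAs x (proj₂ (roles p))
    asSecond p ((_ , g) , (_ , n)) = g , n

    -- Winning strategies are non-losing, so `only` excludes winning strategies of the other players
    -- as well; it also refutes the premise of the second conjunct.
    decisive : ∀ p → HasWinningAs x (proj₁ (roles p)) → HasWinningAs x (proj₂ (roles p)) →
               (∀ q → HasNonLosing x q → q ≡ p) → Classification x
    decisive p (f , w) (g , w′) only =
      inj₁ (p , ((f , g) , (w , w′)) ,
            (λ { q q≢p ((f , g) , (w , w′)) → q≢p (only q (hasNonLosing q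
                   (winning⇒nonLosing (f , w)) (winning⇒nonLosing (g , w′)))) }) ,
            (λ q q≢p n → q≢p (only q n))) ,
      λ (q , q′ , q≢q′ , n , n′) → ⊥-elim (q≢q′ (trans (only q n) (sym (only q′ n′))))

    undecided : ∀ p q → p ≢ q → HasNonLosing x p → HasNonLosing x q → Balanced x → Classification x
    undecided p q p≢q n n′ b = inj₂ (p , q , p≢q , n , n′) , λ _ → b

    -- `LI` meets `RII` when Left starts and `RI` meets `LII` when Right starts; each player takes
    -- one role in each game. Two decided games leave one player; one decided game leaves the two
    -- players who share its winning role, one of L, R and one of I, II; two drawn games leave all
    -- four.
    classify : Verdict x LI → Verdict x RI → Classification x
    classify (inj₁ (w , ¬RII)) (inj₁ (w′ , ¬LII)) = decisive I w w′ λ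
      { L n → ⊥-elim (¬LII (asSecond L n)) ; R n → ⊥-elim (¬RII (asSecond R n))
      ; I _ → refl ; II n → ⊥-elim (¬LII (asFirst II n)) }
    classify (inj₁ (w , ¬RII)) (inj₂ (inj₁ (w′ , ¬RI))) = decisive L w w′ λ
      { L _ → refl ; R n → ⊥-elim (¬RI (asFirst R n))
      ; I n → ⊥-elim (¬RI (asSecond I n)) ; II n → ⊥-elim (¬RII (asSecond II n)) }
    classify (inj₂ (inj₁ (w , ¬LI))) (inj₁ (w′ , ¬LII)) = decisive R w′ w λ
      { L n → ⊥-elim (¬LI (asFirst L n)) ; R _ → refl
      ; I n → ⊥-elim (¬LI (asFirst I n)) ; II n → ⊥-elim (¬LII (asFirst II n)) }
    classify (inj₂ (inj₁ (w , ¬LI))) (inj₂ (inj₁ (w′ , ¬RI))) = decisive II w′ w λ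
      { L n → ⊥-elim (¬LI (asFirst L n)) ; R n → ⊥-elim (¬RI (asFirst R n))
      ; I n → ⊥-elim (¬LI (asFirst I n)) ; II _ → refl }
    classify (inj₁ (w , ¬RII)) (inj₂ (inj₂ (nRI , nLII))) =
      undecided L I (λ ()) nL nI (inj₁
        ((inj₁ nL , λ (_ , n) → ¬RII (asSecond R n)) , (inj₁ nI , λ (_ , n) → ¬RII (asSecond II n))))
      where
      nL = hasNonLosing L (winning⇒nonLosing w) nLII
      nI = hasNonLosing I (winning⇒nonLosing w) nRI
    classify (inj₂ (inj₁ (w , ¬LI))) (inj₂ (inj₂ (nRI , nLII))) =
      undecided R II (λ ()) nR nII (inj₁
        ((inj₂ nR , λ (n , _) → ¬LI (asFirst L n)) , (inj₂ nII , λ (n , _) → ¬LI (asFirst I n))))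
      where
      nR  = hasNonLosing R nRI (winning⇒nonLosing w)
      nII = hasNonLosing II nLII (winning⇒nonLosing w)
    classify (inj₂ (inj₂ (nLI , nRII))) (inj₁ (w , ¬LII)) =
      undecided R I (λ ()) nR nI (inj₁
        ((inj₂ nR , λ (n , _) → ¬LII (asSecond L n)) , (inj₁ nI , λ (_ , n) → ¬LII (asFirst II n))))
      where
      nR = hasNonLosing R (winning⇒nonLosing w) nRII
      nI = hasNonLosing I nLI (winning⇒nonLosing w)
    classify (inj₂ (inj₂ (nLI , nRII))) (inj₂ (inj₁ (w , ¬RI))) =
      undecided L II (λ ()) nL nII (inj₁
        ((inj₁ nL , λ (_ , n) → ¬RI (asFirst R n)) , (inj₂ nII , λ (n , _) → ¬RI (asSecond I n))))
      where
      nL  = hasNonLosing L nLI (winning⇒nonLosing w)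
      nII = hasNonLosing II (winning⇒nonLosing w) nRII
    classify (inj₂ (inj₂ (nLI , nRII))) (inj₂ (inj₂ (nRI , nLII))) =
      undecided L R (λ ()) (all L) (all R) (inj₂ all)
      where
      all : ∀ p → HasNonLosing x p
      all L  = hasNonLosing L nLI nLII
      all R  = hasNonLosing R nRI nRII
      all I  = hasNonLosing I nLI nRI
      all II = hasNonLosing II nLII nRII

theorem2p14 : ∀ (ℓ : Level) → ExcludedMiddle (suc ℓ) → AxiomOfChoice ℓ (suc ℓ) →
    (𝓗 : FinalCoalgebra ℓ) → let open Hypergames 𝓗 in
    (x : Hypergame) →
    ( (∃[ p ] ( HasWinning x p
    × (∀ q → q ≢ p → ¬ HasWinning x q)
    × (∀ q → q ≢ p → ¬ HasNonLosing x q)))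
    ⊎
    (∃[ p ] ∃[ q ] (p ≢ q × HasNonLosing x p × HasNonLosing x q)) )
    ×
    ( (∃[ p ] ∃[ q ] (p ≢ q × HasNonLosing x p × HasNonLosing x q)) →
    ( ExactlyOneOf (HasNonLosing x L) (HasNonLosing x R)
    × ExactlyOneOf (HasNonLosing x I) (HasNonLosing x II) )
    ⊎
    (∀ p → HasNonLosing x p) )
theorem2p14 ℓ em ac 𝓗 x = classify (verdict x LI) (verdict x RI)
  where open Determinacy em ac 𝓗
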